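{- Let $G$ and $H$ be finite simple graphs and let $\varphi(g_1,g_2,h_1,h_2)$ be a logical formula built from the atomic formulas $g_1g_2\in E(G)$, $h_1h_2\in E(H)$, $g_1=g_2$, $h_1=h_2$ using the connectives $\wedge,\vee,\neg,\Rightarrow$. Suppose that $\varphi$ satisfies \[ \bigl((h_1=h_2)\wedge\neg(g_1g_2\in E(G))\bigr)\Rightarrow\neg\varphi(g_1,g_2,h_1,h_2) \] for all $g_1,g_2\in V(G)$ and $h_1,h_2\in V(H)$. If $G$ is opposable, then $G\varphi H$ is opposable.
   Context: All graphs are finite and simple. $N[v]$ denotes the closed neighbourhood of $v$. An opposition of a graph $G$ is an automorphism $f$ of $G$ of order two, in the sense $f\circ f=\mathrm{id}$, such that $f(v)\notin N[v]$ for all $v\in V(G)$. A graph is opposable if it has an opposition (the empty graph is vacuously opposable). For a formula $\varphi$ as in the claim, $G\varphi H$ denotes the graph with vertex set $V(G)\times V(H)$ in which $(g_1,h_1)(g_2,h_2)$ is an edge if and only if $\varphi(g_1,g_2,h_1,h_2)$ holds. -}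

module Defs where

open import Level using (0ℓ)
open import Data.Nat using (ℕ; _*_)
open import Data.Fin using (Fin)
import Data.Fin.Properties as Fin
open import Data.Product using (∃; _×_; _,_; proj₂)
open import Data.Product.Function.NonDependent.Propositional using (_×-↔_)
open import Data.Sum using (_⊎_)
import Data.Sum as Sum
open import Function.Base using (_∘_)
open import Function.Bundles using (_↔_; _⇔_; Inverse)
open import Function.Construct.Composition using (_↔-∘_)
open import Function.Construct.Symmetry using (↔-sym)
open import Function.Properties.Inverse using (↔⇒↣)
open import Relation.Binary.Core using (Rel)
open import Relation.Binary.Definitions
  using (Decidable; DecidableEquality; Irreflexive; Symmetric)
open import Relation.Binary.PropositionalEquality using (_≡_; refl; sym)
open import Relation.Nullary using (¬_; Dec; ¬?)
open import Relation.Nullary.Decidable using (_×-dec_; _⊎-dec_; _→-dec_; via-injection)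
open import Relation.Unary using (Pred; _∉_)

Finite : Set → Set
Finite A = ∃ λ (n : ℕ) → A ↔ Fin n

-- Classically every relation on a finite set is decidable; constructively
-- this is part of what it means for the edge set to be finite.
record Graph : Set₁ where
  field
    V       : Set
    finite  : Finite V
    E       : Rel V 0ℓ
    E?      : Decidable E
    E-sym   : Symmetric E
    E-irrefl : Irreflexive _≡_ E

  _≟_ : DecidableEquality V
  _≟_ = via-injection (↔⇒↣ (proj₂ finite)) Fin._≟_

  N[_] : V → Pred V 0ℓ
  N[ v ] u = u ≡ v ⊎ E v u

open Graph using (V; E)

record Automorphism (G : Graph) : Set where
  field
    bijection : V G ↔ V G

  open Inverse bijection public using (to)

  field
    preserves-E : ∀ u v → E G u v ⇔ E G (to u) (to v)

-- "Order two" means f ∘ f = id, so the empty graph is (vacuously) opposable.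
record Opposition (G : Graph) : Set where
  open Graph G using (N[_])

  field
    automorphism : Automorphism G

  open Automorphism automorphism public renaming (to to f)

  field
    involutive : ∀ v → f (f v) ≡ v
    opposes    : ∀ v → f v ∉ N[ v ]

Opposable : Graph → Set
Opposable = Opposition

infixr 7 _∧′_
infixr 6 _∨′_
infixr 5 _⇒′_

data Formula : Set where
  g₁g₂∈E g₁=g₂ h₁h₂∈E h₁=h₂ : Formula
  _∧′_ _∨′_ _⇒′_ : Formula → Formula → Formula
  ¬′_ : Formula → Formula

module _ (G H : Graph) where

  Holds : Formula → (g₁ g₂ : V G) (h₁ h₂ : V H) → Set
  Holds g₁g₂∈E   g₁ g₂ h₁ h₂ = E G g₁ g₂
  Holds g₁=g₂    g₁ g₂ h₁ h₂ = g₁ ≡ g₂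
  Holds h₁h₂∈E   g₁ g₂ h₁ h₂ = E H h₁ h₂
  Holds h₁=h₂    g₁ g₂ h₁ h₂ = h₁ ≡ h₂
  Holds (φ ∧′ ψ) g₁ g₂ h₁ h₂ = Holds φ g₁ g₂ h₁ h₂ × Holds ψ g₁ g₂ h₁ h₂
  Holds (φ ∨′ ψ) g₁ g₂ h₁ h₂ = Holds φ g₁ g₂ h₁ h₂ ⊎ Holds ψ g₁ g₂ h₁ h₂
  Holds (φ ⇒′ ψ) g₁ g₂ h₁ h₂ = Holds φ g₁ g₂ h₁ h₂ → Holds ψ g₁ g₂ h₁ h₂
  Holds (¬′ φ)   g₁ g₂ h₁ h₂ = ¬ Holds φ g₁ g₂ h₁ h₂

  holds? : ∀ φ g₁ g₂ h₁ h₂ → Dec (Holds φ g₁ g₂ h₁ h₂)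
  holds? g₁g₂∈E   g₁ g₂ h₁ h₂ = Graph.E? G g₁ g₂
  holds? g₁=g₂    g₁ g₂ h₁ h₂ = Graph._≟_ G g₁ g₂
  holds? h₁h₂∈E   g₁ g₂ h₁ h₂ = Graph.E? H h₁ h₂
  holds? h₁=h₂    g₁ g₂ h₁ h₂ = Graph._≟_ H h₁ h₂
  holds? (φ ∧′ ψ) g₁ g₂ h₁ h₂ = holds? φ g₁ g₂ h₁ h₂ ×-dec holds? ψ g₁ g₂ h₁ h₂
  holds? (φ ∨′ ψ) g₁ g₂ h₁ h₂ = holds? φ g₁ g₂ h₁ h₂ ⊎-dec holds? ψ g₁ g₂ h₁ h₂
  holds? (φ ⇒′ ψ) g₁ g₂ h₁ h₂ = holds? φ g₁ g₂ h₁ h₂ →-dec holds? ψ g₁ g₂ h₁ h₂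
  holds? (¬′ φ)   g₁ g₂ h₁ h₂ = ¬? (holds? φ g₁ g₂ h₁ h₂)

  holds-sym : ∀ φ {g₁ g₂ h₁ h₂} → Holds φ g₁ g₂ h₁ h₂ → Holds φ g₂ g₁ h₂ h₁
  holds-sym g₁g₂∈E   = Graph.E-sym G
  holds-sym g₁=g₂    = sym
  holds-sym h₁h₂∈E   = Graph.E-sym H
  holds-sym h₁=h₂    = sym
  holds-sym (φ ∧′ ψ) (p , q) = holds-sym φ p , holds-sym ψ q
  holds-sym (φ ∨′ ψ) = Sum.map (holds-sym φ) (holds-sym ψ)
  holds-sym (φ ⇒′ ψ) p = holds-sym ψ ∘ p ∘ holds-sym φ
  holds-sym (¬′ φ)   p = p ∘ holds-sym φ

  -- A formula such as g₁=g₂ would put a loop at every vertex, so the product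
  -- GφH is a simple graph only for formulas that fail on the diagonal.
  Loopless : Formula → Set
  Loopless φ = ∀ g h → ¬ Holds φ g g h h

  product : (φ : Formula) → Loopless φ → Graph
  product φ loopless = record
    { V        = V G × V H
    ; finite   = let m , V↔m = Graph.finite G ; n , V↔n = Graph.finite H in
                 m * n , ↔-sym Fin.*↔× ↔-∘ (V↔m ×-↔ V↔n)
    ; E        = λ (g₁ , h₁) (g₂ , h₂) → Holds φ g₁ g₂ h₁ h₂
    ; E?       = λ (g₁ , h₁) (g₂ , h₂) → holds? φ g₁ g₂ h₁ h₂
    ; E-sym    = holds-sym φ
    ; E-irrefl = λ { {g , h} refl → loopless g h }
    }

  condition⇒loopless : ∀ φ →
    (∀ g₁ g₂ h₁ h₂ → (h₁ ≡ h₂ × ¬ E G g₁ g₂) → ¬ Holds φ g₁ g₂ h₁ h₂) →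
    Loopless φ
  condition⇒loopless φ c g h = c g g h h (refl , Graph.E-irrefl G refl)

{-# OPTIONS --safe #-}
-- If f is an opposition of G then f × id is one of GφH: automorphisms of G
-- preserve the truth of φ, and since g is not adjacent to f g, the hypothesis on
-- φ says that (g , h) is not adjacent to (f g , h).
module Submission where

open import Data.Product using (_×_; _,_; proj₁)
open import Data.Product.Function.NonDependent.Propositional using (_×-⇔_; _×-↔_)
open import Data.Sum using (inj₁; inj₂)
open import Data.Sum.Function.Propositional using (_⊎-⇔_)
open import Function.Base using (_∘_)
open import Function.Bundles using (_⇔_; mk⇔; Injection)
open import Function.Construct.Identity using (⇔-id; ↔-id)
open import Function.Properties.Inverse using (↔⇒↣)
open import Function.Related.TypeIsomorphisms using (→-cong-⇔; ¬-cong-⇔)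
open import Relation.Binary.PropositionalEquality using (_≡_; refl; cong)
open import Relation.Nullary using (¬_)
open import Defs
open Graph using (V; E)

module _ (G H : Graph) (α : Automorphism G) where
  open Automorphism α

  -- Induction on `φ`, with the vertices fixed. An equivalence is needed, since `¬′_` and the left
  -- side of `_⇒′_` reverse implications.
  automorphism-preserves-Holds : ∀ φ g₁ g₂ h₁ h₂ →
    Holds G H φ g₁ g₂ h₁ h₂ ⇔ Holds G H φ (to g₁) (to g₂) h₁ h₂
  automorphism-preserves-Holds φ g₁ g₂ h₁ h₂ = go φ
    where
    go : ∀ φ → Holds G H φ g₁ g₂ h₁ h₂ ⇔ Holds G H φ (to g₁) (to g₂) h₁ h₂
    go g₁g₂∈E   = preserves-E g₁ g₂
    -- The converse direction is injectivity of the automorphism.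
    go g₁=g₂    = mk⇔ (cong to) (Injection.injective (↔⇒↣ bijection))
    go h₁h₂∈E   = ⇔-id _
    go h₁=h₂    = ⇔-id _
    go (φ ∧′ ψ) = go φ ×-⇔ go ψ
    go (φ ∨′ ψ) = go φ ⊎-⇔ go ψ
    go (φ ⇒′ ψ) = →-cong-⇔ (go φ) (go ψ)
    go (¬′ φ)   = ¬-cong-⇔ (go φ)

  product-automorphism : ∀ φ loopless → Automorphism (product G H φ loopless)
  product-automorphism φ loopless = record
    { bijection   = bijection ×-↔ ↔-id (V H)
    ; preserves-E = λ (g₁ , h₁) (g₂ , h₂) →
        automorphism-preserves-Holds φ g₁ g₂ h₁ h₂
    }

theorem2p6 : (G H : Graph) (φ : Formula)
    (condition : (g₁ g₂ : V G) (h₁ h₂ : V H) → (h₁ ≡ h₂ × ¬ E G g₁ g₂) → ¬ Holds G H φ g₁ g₂ h₁ h₂) →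
    Opposable G → Opposable (product G H φ (condition⇒loopless G H φ condition))
theorem2p6 G H φ condition opposition = record
  { automorphism = product-automorphism G H automorphism φ
                     (condition⇒loopless G H φ condition)
  ; involutive   = λ (g , h) → cong (_, h) (involutive g)
  ; opposes      = λ where
      -- A fixed pair would make `g` a fixed point of `f`.
      (g , h) (inj₁ fixed)    → opposes g (inj₁ (cong proj₁ fixed))
      (g , h) (inj₂ adjacent) →
        -- The `inj₂` part of `N[ g ]` holds its neighbours, so `opposes g ∘ inj₂` is the
        -- non-adjacency of `g` and `f g`.
        condition g (f g) h h (refl , opposes g ∘ inj₂) adjacent
  }
  where open Opposition opposition
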